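{- There is a Boolean query definable by a first-order sentence of the form $\exists\vec x\,\forall\vec y\,\psi$ with $\psi$ quantifier-free which cannot be maintained by a $\mathrm{DynProp}$-program with unary auxiliary functions (with auxiliary relations of any arity).
   Context: Dynamic complexity framework with auxiliary functions. A dynamic schema is a pair $(\tau_{\mathrm{in}},\tau_{\mathrm{aux}})$; $\tau_{\mathrm{aux}}$ consists of relation symbols and function symbols of arity at most $1$ (constants being $0$-ary functions); $\tau=\tau_{\mathrm{in}}\cup\tau_{\mathrm{aux}}$. A modification is an insertion $\mathrm{ins}_S(\vec a)$ or deletion $\mathrm{del}_S(\vec a)$ of a tuple $\vec a$ into/from $S\in\tau_{\mathrm{in}}$. The update program contains, for each auxiliary relation symbol $R$ and each $\delta\in\{\mathrm{ins}_S,\mathrm{del}_S\}$, a quantifier-free formula $\varphi^R_\delta(\vec x;\vec y)$ over $\tau$ (terms may use the function symbols), and for each auxiliary function symbol $f$ an update term $t^f_\delta(\vec x;\vec y)$ built from variables, function symbols of $\tau$ and the if-then-else construct $\mathrm{ITE}(\varphi,t_1,t_2)$ with $\varphi$ quantifier-free. Program states are $(D,\mathcal I,\mathcal A)$ over a finite domain $D$. Applying $\delta(\vec a)$ to a state $\mathcal S$ modifies the input by $\delta(\vec a)$, reinterprets each $R$ as $\{\vec b:\mathcal S\models\varphi^R_\delta(\vec a;\vec b)\}$ and each $f$ by $\vec b\mapsto t^f_\delta(\vec a;\vec b)$ evaluated in $\mathcal S$; sequences are applied one after another. A dynamic program $(P,\mathrm{Init},Q)$ has an arbitrary initialization mapping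 $\mathrm{Init}$ and a designated $0$-ary query symbol $Q$; it maintains a Boolean query $\mathcal Q$ if for every input database $\mathcal D$ over any finite domain and every sequence $\alpha$ of modifications, the value of $Q$ in the state reached from $(D,\mathcal D,\mathrm{Init}(\mathcal D))$ by $\alpha$ equals $\mathcal Q(\alpha(\mathcal D))$. -}

module Defs where

open import Data.Nat using (ℕ; suc)
open import Data.Fin using (Fin)
open import Data.Fin.Properties using () renaming (_≟_ to _≟ᶠ_)
open import Data.Vec using (Vec; []; lookup; map)
open import Data.Vec.Properties using (≡-dec)
open import Data.Bool using (Bool; true; false; not; _∧_; _∨_; if_then_else_)
open import Data.Sum using (_⊎_; [_,_])
open import Data.Product using (Σ; ∃; _×_; _,_; proj₂)
open import Data.List using (List; []; _∷_)
open import Relation.Nullary.Decidable using (⌊_⌋; yes; no)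
open import Relation.Binary.PropositionalEquality using (_≡_; refl; subst; sym)
open import Function.Bundles using (_⇔_)

record RelSchema : Set where
  field
    nRel  : ℕ
    arity : Fin nRel → ℕ
open RelSchema public

-- An auxiliary schema: relation symbols of any arity, constants
-- (0-ary function symbols) and unary function symbols.
record AuxSchema : Set where
  field
    rels   : RelSchema
    nConst : ℕ
    nFun   : ℕ
open AuxSchema public

emptyAux : AuxSchema
emptyAux = record { rels = record { nRel = 0 ; arity = λ () } ; nConst = 0 ; nFun = 0 }

data Term (A : AuxSchema) (V : Set) : Set where
  var   : V → Term A V
  const : Fin (nConst A) → Term A V
  app   : Fin (nFun A) → Term A V → Term A V

data QF (σ : RelSchema) (A : AuxSchema) (V : Set) : Set where
  inRel  : (S : Fin (nRel σ)) → Vec (Term A V) (arity σ S) → QF σ A V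
  auxRel : (R : Fin (nRel (rels A))) → Vec (Term A V) (arity (rels A) R) → QF σ A V
  eq     : Term A V → Term A V → QF σ A V
  neg    : QF σ A V → QF σ A V
  conj   : QF σ A V → QF σ A V → QF σ A V
  disj   : QF σ A V → QF σ A V → QF σ A V

data UTerm (σ : RelSchema) (A : AuxSchema) (V : Set) : Set where
  var   : V → UTerm σ A V
  const : Fin (nConst A) → UTerm σ A V
  app   : Fin (nFun A) → UTerm σ A V → UTerm σ A V
  ite   : QF σ A V → UTerm σ A V → UTerm σ A V → UTerm σ A V

Database : RelSchema → ℕ → Set
Database σ N = (S : Fin (nRel σ)) → Vec (Fin N) (arity σ S) → Bool

record AuxStr (A : AuxSchema) (N : ℕ) : Set where
  field
    relI   : (R : Fin (nRel (rels A))) → Vec (Fin N) (arity (rels A) R) → Bool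
    constI : Fin (nConst A) → Fin N
    funI   : Fin (nFun A) → Fin N → Fin N
open AuxStr public

evalT : ∀ {A V N} → AuxStr A N → (V → Fin N) → Term A V → Fin N
evalT 𝒜 ν (var v)   = ν v
evalT 𝒜 ν (const c) = constI 𝒜 c
evalT 𝒜 ν (app f t) = funI 𝒜 f (evalT 𝒜 ν t)

evalF : ∀ {σ A V N} → Database σ N → AuxStr A N → (V → Fin N) → QF σ A V → Bool
evalF ℐ 𝒜 ν (inRel S ts)  = ℐ S (map (evalT 𝒜 ν) ts)
evalF ℐ 𝒜 ν (auxRel R ts) = relI 𝒜 R (map (evalT 𝒜 ν) ts)
evalF ℐ 𝒜 ν (eq t u)      = ⌊ evalT 𝒜 ν t ≟ᶠ evalT 𝒜 ν u ⌋
evalF ℐ 𝒜 ν (neg φ)       = not (evalF ℐ 𝒜 ν φ)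
evalF ℐ 𝒜 ν (conj φ ψ)    = evalF ℐ 𝒜 ν φ ∧ evalF ℐ 𝒜 ν ψ
evalF ℐ 𝒜 ν (disj φ ψ)    = evalF ℐ 𝒜 ν φ ∨ evalF ℐ 𝒜 ν ψ

evalU : ∀ {σ A V N} → Database σ N → AuxStr A N → (V → Fin N) → UTerm σ A V → Fin N
evalU ℐ 𝒜 ν (var v)     = ν v
evalU ℐ 𝒜 ν (const c)   = constI 𝒜 c
evalU ℐ 𝒜 ν (app f t)   = funI 𝒜 f (evalU ℐ 𝒜 ν t)
evalU ℐ 𝒜 ν (ite φ t u) = if evalF ℐ 𝒜 ν φ then evalU ℐ 𝒜 ν t else evalU ℐ 𝒜 ν u

record Mod (σ : RelSchema) (N : ℕ) : Set where
  constructor mod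
  field
    isIns : Bool
    rel   : Fin (nRel σ)
    tuple : Vec (Fin N) (arity σ rel)
open Mod public

applyMod : ∀ {σ N} → Mod σ N → Database σ N → Database σ N
applyMod (mod b S a) ℐ S′ t with S ≟ᶠ S′
... | no _    = ℐ S′ t
... | yes refl = if ⌊ ≡-dec _≟ᶠ_ a t ⌋ then b else ℐ S t

applyMods : ∀ {σ N} → List (Mod σ N) → Database σ N → Database σ N
applyMods []       ℐ = ℐ
applyMods (δ ∷ α) ℐ = applyMods α (applyMod δ ℐ)

record UpdateProgram (σ : RelSchema) (A : AuxSchema) : Set where
  field
    -- φ^R_δ(x⃗; y⃗), δ = ins_S (true) / del_S (false)
    updRel   : (b : Bool) (S : Fin (nRel σ)) (R : Fin (nRel (rels A))) →
               QF σ A (Fin (arity σ S) ⊎ Fin (arity (rels A) R))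
    updConst : (b : Bool) (S : Fin (nRel σ)) → Fin (nConst A) →
               UTerm σ A (Fin (arity σ S))
    updFun   : (b : Bool) (S : Fin (nRel σ)) → Fin (nFun A) →
               UTerm σ A (Fin (arity σ S) ⊎ Fin 1)
open UpdateProgram public

State : RelSchema → AuxSchema → ℕ → Set
State σ A N = Database σ N × AuxStr A N

step : ∀ {σ A N} → UpdateProgram σ A → Mod σ N → State σ A N → State σ A N
step P (mod b S a) (ℐ , 𝒜) =
  applyMod (mod b S a) ℐ ,
  record
    { relI   = λ R t → evalF ℐ 𝒜 [ lookup a , lookup t ] (updRel P b S R)
    ; constI = λ c → evalU ℐ 𝒜 (lookup a) (updConst P b S c)
    ; funI   = λ f e → evalU ℐ 𝒜 [ lookup a , (λ _ → e) ] (updFun P b S f)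
    }

run : ∀ {σ A N} → UpdateProgram σ A → List (Mod σ N) → State σ A N → State σ A N
run P []       𝒮 = 𝒮
run P (δ ∷ α) 𝒮 = run P α (step P δ 𝒮)

queryValue : ∀ {σ A N} (Q : Fin (nRel (rels A))) → arity (rels A) Q ≡ 0 →
             State σ A N → Bool
queryValue Q p 𝒮 = relI (proj₂ 𝒮) Q (subst (Vec _) (sym p) [])

BoolQuery : RelSchema → Set₁
BoolQuery σ = (n : ℕ) → Database σ (suc n) → Set

Maintains : ∀ {σ A} → UpdateProgram σ A →
            (Init : (n : ℕ) → Database σ (suc n) → AuxStr A (suc n)) →
            (Q : Fin (nRel (rels A))) → arity (rels A) Q ≡ 0 →
            BoolQuery σ → Set
Maintains {σ} P Init Q p 𝒬 =
  (n : ℕ) (𝒟 : Database σ (suc n)) (α : List (Mod σ (suc n))) →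
  (queryValue Q p (run P α (𝒟 , Init n 𝒟)) ≡ true) ⇔ 𝒬 n (applyMods α 𝒟)

EAQuery : ∀ {σ k m} → QF σ emptyAux (Fin k ⊎ Fin m) → BoolQuery σ
EAQuery {σ} {k} {m} ψ n 𝒟 =
  Σ (Fin k → Fin (suc n)) λ x → (y : Fin m → Fin (suc n)) →
    evalF 𝒟 emptyStr [ x , y ] ψ ≡ true
  where
  emptyStr : AuxStr emptyAux (suc n)
  emptyStr = record { relI = λ () ; constI = λ () ; funI = λ () }

{-# OPTIONS --safe #-}

-- The query is ∃x∀y (U(y) → E(x,y)). Take points (w,j), w < m, j < n, and rows s ∈ [n]^m, and let a
-- set F ⊆ [n]^m be encoded in E by joining each row s ∈ F to the points (w, s w). After inserting the
-- points of a tuple s into the empty set U, the query asks whether s ∈ F.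
--
-- For a fixed program and fixed m, the answer after m insertions is a decision tree over atoms of the
-- initial state, in the m inserted elements. As function symbols are at most unary, a term contains at
-- most one variable, so an atom mentions at most r of them, where r depends on the schemas only. Hence
-- K atoms carry at most K n^r bits of information about F. With m = r + 1 and n = K + 1 this is less
-- than n^m, so two different sets F are confused.
module Submission where

open import Defs
open import Data.Nat using (ℕ; zero; suc; _+_; _*_; _^_; _≤_; _<_; _⊔_; z≤n; s≤s)
open import Data.Nat.Properties
  using (≤-reflexive; ≤-trans; +-mono-≤; m≤m⊔n; m≤n⊔m; m≤m+n; m≤n+m; m^n>0; ^-monoʳ-<; m<n+m)
open import Data.Fin
  using (Fin; zero; suc; _↑ˡ_; _↑ʳ_; splitAt; combine; remQuot; punchIn; punchOut; finToFun; funToFin)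
open import Data.Fin.Properties
  using (pigeonhole; 2↔Bool; ¬∀⟶∃¬; remQuot-combine; splitAt-↑ˡ; splitAt-↑ʳ; punchIn-punchOut;
         finToFun-funToFin; funToFin-finToFin; <⇒≢)
  renaming (_≟_ to _≟ᶠ_)
open import Data.Bool using (Bool; true; false; not; _∧_; _∨_; if_then_else_)
open import Data.Sum using (_⊎_; inj₁; inj₂; [_,_])
open import Data.Product using (Σ; ∃; ∃₂; _×_; _,_; proj₁; proj₂)
open import Data.List as List using (List; []; _∷_; length; allFin)
open import Data.List.Properties using (length-++)
open import Data.List.Relation.Unary.Any using (here; there; index)
open import Data.List.Relation.Unary.Any.Properties using (lookup-index)
open import Data.List.Membership.Propositional using (_∈_; _∉_)
open import Data.List.Membership.Propositional.Properties using (∈-++⁺ˡ; ∈-++⁺ʳ; ∈-allFin)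
import Data.List.Membership.DecPropositional as DecMembership
open import Data.Vec using (Vec; []; _∷_; lookup; map)
open import Data.Vec.Properties using (≡-dec; lookup-map; map-∘)
open import Data.Vec.Functional using (insertAt; removeAt; foldr)
open import Data.Vec.Functional.Properties using (insertAt-punchIn)
open import Function using (_∘_)
open import Function.Bundles using (_⇔_; mk⇔; Equivalence; Inverse; Injection)
open import Function.Properties.Inverse using (Inverse⇒Injection; ↔-sym)
open import Relation.Nullary using (¬_; yes; no; contradiction)
open import Relation.Nullary.Decidable using (⌊_⌋)
open import Relation.Binary.PropositionalEquality
  using (_≡_; _≢_; _≗_; refl; sym; trans; cong; cong₂; subst; module ≡-Reasoning)
open ≡-Reasoning

-- Decision trees over atomic formulas

data Atom (σ : RelSchema) (A : AuxSchema) (V : Set) : Set where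
  inRel  : (S : Fin (nRel σ)) → Vec (Term A V) (arity σ S) → Atom σ A V
  auxRel : (R : Fin (nRel (rels A))) → Vec (Term A V) (arity (rels A) R) → Atom σ A V
  eq     : Term A V → Term A V → Atom σ A V

-- The leaf type varies because formulas give trees with Boolean leaves, while update terms give
-- trees whose leaves are terms.
data Tree (σ : RelSchema) (A : AuxSchema) (V X : Set) : Set where
  leaf : X → Tree σ A V X
  node : Atom σ A V → Tree σ A V X → Tree σ A V X → Tree σ A V X

module _ {σ : RelSchema} {A : AuxSchema} {V : Set} where

  infixl 1 _>>=_

  _>>=_ : ∀ {X Y} → Tree σ A V X → (X → Tree σ A V Y) → Tree σ A V Y
  leaf x     >>= f = f x
  node a l r >>= f = node a (l >>= f) (r >>= f)

  test : Atom σ A V → Tree σ A V Bool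
  test a = node a (leaf true) (leaf false)

  atoms : ∀ {X} → Tree σ A V X → List (Atom σ A V)
  atoms (leaf _)     = []
  atoms (node a l r) = a ∷ atoms l List.++ atoms r

  module _ {N : ℕ} (𝒮 : State σ A N) (ν : V → Fin N) where

    evalA : Atom σ A V → Bool
    evalA (inRel S ts)  = proj₁ 𝒮 S (map (evalT (proj₂ 𝒮) ν) ts)
    evalA (auxRel R ts) = relI (proj₂ 𝒮) R (map (evalT (proj₂ 𝒮) ν) ts)
    evalA (eq t u)      = ⌊ evalT (proj₂ 𝒮) ν t ≟ᶠ evalT (proj₂ 𝒮) ν u ⌋

    eval : ∀ {X} → Tree σ A V X → X
    eval (leaf x)     = x
    eval (node a l r) = if evalA a then eval l else eval r

    eval->>= : ∀ {X Y} (d : Tree σ A V X) (f : X → Tree σ A V Y) →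
               eval (d >>= f) ≡ eval (f (eval d))
    eval->>= (leaf x)     f = refl
    eval->>= (node a l r) f with evalA a
    ... | true  = eval->>= l f
    ... | false = eval->>= r f

    eval-test : ∀ a → eval (test a) ≡ evalA a
    eval-test a with evalA a
    ... | true  = refl
    ... | false = refl

  -- Both evaluations take the same branch at every node. The list `atoms d` collects the nodes of
  -- all branches, so the adaptive questions of a tree are replaced by one fixed list.
  eval-agree : ∀ {N N′} (𝒮 : State σ A N) (ν : V → Fin N) (𝒮′ : State σ A N′) (ν′ : V → Fin N′)
               {X} (d : Tree σ A V X) →
               (∀ {a} → a ∈ atoms d → evalA 𝒮 ν a ≡ evalA 𝒮′ ν′ a) → eval 𝒮 ν d ≡ eval 𝒮′ ν′ d
  eval-agree 𝒮 ν 𝒮′ ν′ (leaf x)     h = refl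
  eval-agree 𝒮 ν 𝒮′ ν′ (node a l r) h with evalA 𝒮 ν a | evalA 𝒮′ ν′ a | h (here refl)
  ... | true  | .true  | refl = eval-agree 𝒮 ν 𝒮′ ν′ l (h ∘ there ∘ ∈-++⁺ˡ)
  ... | false | .false | refl = eval-agree 𝒮 ν 𝒮′ ν′ r (h ∘ there ∘ ∈-++⁺ʳ (atoms l))

  equalTree : ∀ {n} → Vec (Term A V) n → Vec (Term A V) n → Tree σ A V Bool
  equalTree []       []       = leaf true
  equalTree (t ∷ ts) (u ∷ us) = node (eq t u) (equalTree ts us) (leaf false)

  eval-equalTree : ∀ {N} (𝒮 : State σ A N) ν {n} (ts us : Vec (Term A V) n) →
    eval 𝒮 ν (equalTree ts us) ≡
    ⌊ ≡-dec _≟ᶠ_ (map (evalT (proj₂ 𝒮) ν) ts) (map (evalT (proj₂ 𝒮) ν) us) ⌋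
  eval-equalTree 𝒮 ν []       []       = refl
  eval-equalTree 𝒮 ν (t ∷ ts) (u ∷ us)
    rewrite eval-equalTree 𝒮 ν ts us
    with evalT (proj₂ 𝒮) ν t ≟ᶠ evalT (proj₂ 𝒮) ν u
       | ≡-dec _≟ᶠ_ (map (evalT (proj₂ 𝒮) ν) ts) (map (evalT (proj₂ 𝒮) ν) us)
  ... | yes _ | yes _ = refl
  ... | yes _ | no _  = refl
  ... | no _  | _     = refl

-- Formulas and update terms as decision trees

module _ {A : AuxSchema} {V W : Set} (θ : W → Term A V) where

  substT : Term A W → Term A V
  substT (var w)   = θ w
  substT (const c) = const c
  substT (app f t) = app f (substT t)

module _ {σ : RelSchema} {A : AuxSchema} {V W : Set} (θ : W → Term A V) where

  qfTree : QF σ A W → Tree σ A V Bool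
  qfTree (inRel S ts)  = test (inRel S (map (substT θ) ts))
  qfTree (auxRel R ts) = test (auxRel R (map (substT θ) ts))
  qfTree (eq t u)      = test (eq (substT θ t) (substT θ u))
  qfTree (neg φ)       = qfTree φ >>= λ b → leaf (not b)
  qfTree (conj φ ψ)    = qfTree φ >>= λ b → qfTree ψ >>= λ c → leaf (b ∧ c)
  qfTree (disj φ ψ)    = qfTree φ >>= λ b → qfTree ψ >>= λ c → leaf (b ∨ c)

  -- The conditions of all `ite` move into the nodes, so each leaf holds an ordinary term, which
  -- mentions at most one variable.
  utermTree : UTerm σ A W → Tree σ A V (Term A V)
  utermTree (var w)     = leaf (θ w)
  utermTree (const c)   = leaf (const c)
  utermTree (app f t)   = utermTree t >>= λ t′ → leaf (app f t′)
  utermTree (ite φ t u) = qfTree φ >>= λ b → if b then utermTree t else utermTree u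

  module _ {N : ℕ} (𝒮 : State σ A N) (ν : V → Fin N) (μ : W → Fin N)
           (hyp : ∀ w → evalT (proj₂ 𝒮) ν (θ w) ≡ μ w) where

    evalT-substT : ∀ t → evalT (proj₂ 𝒮) ν (substT θ t) ≡ evalT (proj₂ 𝒮) μ t
    evalT-substT (var w)   = hyp w
    evalT-substT (const c) = refl
    evalT-substT (app f t) = cong (funI (proj₂ 𝒮) f) (evalT-substT t)

    map-substT : ∀ {n} (ts : Vec (Term A W) n) →
      map (evalT (proj₂ 𝒮) ν) (map (substT θ) ts) ≡ map (evalT (proj₂ 𝒮) μ) ts
    map-substT []       = refl
    map-substT (t ∷ ts) = cong₂ _∷_ (evalT-substT t) (map-substT ts)

    eval-qfTree : ∀ φ → eval 𝒮 ν (qfTree φ) ≡ evalF (proj₁ 𝒮) (proj₂ 𝒮) μ φ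
    eval-qfTree (inRel S ts)  =
      trans (eval-test 𝒮 ν (inRel S _)) (cong (proj₁ 𝒮 S) (map-substT ts))
    eval-qfTree (auxRel R ts) =
      trans (eval-test 𝒮 ν (auxRel R _)) (cong (relI (proj₂ 𝒮) R) (map-substT ts))
    eval-qfTree (eq t u)      =
      trans (eval-test 𝒮 ν (eq (substT θ t) (substT θ u)))
        (cong₂ (λ x y → ⌊ x ≟ᶠ y ⌋) (evalT-substT t) (evalT-substT u))
    eval-qfTree (neg φ)       =
      trans (eval->>= 𝒮 ν (qfTree φ) _) (cong not (eval-qfTree φ))
    eval-qfTree (conj φ ψ)    =
      trans (eval->>= 𝒮 ν (qfTree φ) _)
        (trans (eval->>= 𝒮 ν (qfTree ψ) _) (cong₂ _∧_ (eval-qfTree φ) (eval-qfTree ψ)))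
    eval-qfTree (disj φ ψ)    =
      trans (eval->>= 𝒮 ν (qfTree φ) _)
        (trans (eval->>= 𝒮 ν (qfTree ψ) _) (cong₂ _∨_ (eval-qfTree φ) (eval-qfTree ψ)))

    eval-utermTree : ∀ t →
      evalT (proj₂ 𝒮) ν (eval 𝒮 ν (utermTree t)) ≡ evalU (proj₁ 𝒮) (proj₂ 𝒮) μ t
    eval-utermTree (var w)     = hyp w
    eval-utermTree (const c)   = refl
    eval-utermTree (app f t)   =
      trans (cong (evalT (proj₂ 𝒮) ν) (eval->>= 𝒮 ν (utermTree t) _))
        (cong (funI (proj₂ 𝒮) f) (eval-utermTree t))
    eval-utermTree (ite φ t u)
      rewrite eval->>= 𝒮 ν (qfTree φ) (λ b → if b then utermTree t else utermTree u)
            | eval-qfTree φ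
      with evalF (proj₁ 𝒮) (proj₂ 𝒮) μ φ
    ... | true  = eval-utermTree t
    ... | false = eval-utermTree u

-- Pulling trees back along modifications

-- A modification over the domain Fin M serves as a symbolic one with variables in Fin M.
mapMod : ∀ {σ M N} → (Fin M → Fin N) → Mod σ M → Mod σ N
mapMod ν (mod b S a) = mod b S (map ν a)

module _ {σ : RelSchema} {A : AuxSchema} (P : UpdateProgram σ A) {M : ℕ} where

  module _ (b : Bool) (S : Fin (nRel σ)) (a : Vec (Fin M) (arity σ S)) where

    params : Fin (arity σ S) → Term A (Fin M)
    params = var ∘ lookup a

    -- The …Before functions are weakest preconditions: they compute in the state before the update
    -- what their argument denotes in the state after it.
    termBefore : Term A (Fin M) → Tree σ A (Fin M) (Term A (Fin M))
    termBefore (var v)   = leaf (var v)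
    termBefore (const c) = utermTree params (updConst P b S c)
    termBefore (app f t) =
      termBefore t >>= λ t′ → utermTree [ params , (λ _ → t′) ] (updFun P b S f)

    termsBefore : ∀ {n} → Vec (Term A (Fin M)) n → Tree σ A (Fin M) (Vec (Term A (Fin M)) n)
    termsBefore []       = leaf []
    termsBefore (t ∷ ts) = termBefore t >>= λ t′ → termsBefore ts >>= λ ts′ → leaf (t′ ∷ ts′)

    inputBefore : (R : Fin (nRel σ)) → Vec (Term A (Fin M)) (arity σ R) → Tree σ A (Fin M) Bool
    inputBefore R ts with S ≟ᶠ R
    ... | no _     = test (inRel R ts)
    ... | yes refl = equalTree (map var a) ts >>= λ e → if e then leaf b else test (inRel S ts)

    atomBefore : Atom σ A (Fin M) → Tree σ A (Fin M) Bool
    atomBefore (inRel R ts)  = termsBefore ts >>= inputBefore R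
    atomBefore (auxRel R ts) =
      termsBefore ts >>= λ ts′ → qfTree [ params , lookup ts′ ] (updRel P b S R)
    atomBefore (eq t u)      = termBefore t >>= λ t′ → termBefore u >>= λ u′ → test (eq t′ u′)

    treeBefore : ∀ {X} → Tree σ A (Fin M) X → Tree σ A (Fin M) X
    treeBefore (leaf x)     = leaf x
    treeBefore (node q l r) = atomBefore q >>= λ e → if e then treeBefore l else treeBefore r

    module _ {N : ℕ} (𝒮 : State σ A N) (ν : Fin M → Fin N) where

      private
        𝒮′ : State σ A N
        𝒮′ = step P (mod b S (map ν a)) 𝒮

      eval-params : ∀ i → evalT (proj₂ 𝒮) ν (params i) ≡ lookup (map ν a) i
      eval-params i = sym (lookup-map i ν a)

      eval-termBefore : ∀ t →
        evalT (proj₂ 𝒮) ν (eval 𝒮 ν (termBefore t)) ≡ evalT (proj₂ 𝒮′) ν t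
      eval-termBefore (var v)   = refl
      eval-termBefore (const c) = eval-utermTree params 𝒮 ν _ eval-params (updConst P b S c)
      eval-termBefore (app f t) =
        trans (cong (evalT (proj₂ 𝒮) ν) (eval->>= 𝒮 ν (termBefore t) _))
          (eval-utermTree _ 𝒮 ν _
            (λ { (inj₁ i) → eval-params i ; (inj₂ _) → eval-termBefore t }) (updFun P b S f))

      eval-termsBefore : ∀ {n} (ts : Vec (Term A (Fin M)) n) →
        map (evalT (proj₂ 𝒮) ν) (eval 𝒮 ν (termsBefore ts)) ≡ map (evalT (proj₂ 𝒮′) ν) ts
      eval-termsBefore []       = refl
      eval-termsBefore (t ∷ ts) =
        trans (cong (map (evalT (proj₂ 𝒮) ν))
                (trans (eval->>= 𝒮 ν (termBefore t) _) (eval->>= 𝒮 ν (termsBefore ts) _)))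
          (cong₂ _∷_ (eval-termBefore t) (eval-termsBefore ts))

      eval-inputBefore : ∀ R ts →
        eval 𝒮 ν (inputBefore R ts) ≡ proj₁ 𝒮′ R (map (evalT (proj₂ 𝒮) ν) ts)
      eval-inputBefore R ts with S ≟ᶠ R
      ... | no _     = eval-test 𝒮 ν (inRel R ts)
      ... | yes refl
        rewrite eval->>= 𝒮 ν (equalTree (map var a) ts)
                  (λ e → if e then leaf b else test (inRel S ts))
              | eval-equalTree 𝒮 ν (map var a) ts
              | sym (map-∘ (evalT (proj₂ 𝒮) ν) var a)
        with ≡-dec _≟ᶠ_ (map ν a) (map (evalT (proj₂ 𝒮) ν) ts)
      ...   | yes _ = refl
      ...   | no _  = eval-test 𝒮 ν (inRel S ts)

      eval-atomBefore : ∀ q → eval 𝒮 ν (atomBefore q) ≡ evalA 𝒮′ ν q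
      eval-atomBefore (inRel R ts)  =
        trans (eval->>= 𝒮 ν (termsBefore ts) _)
          (trans (eval-inputBefore R _) (cong (proj₁ 𝒮′ R) (eval-termsBefore ts)))
      eval-atomBefore (auxRel R ts) =
        trans (eval->>= 𝒮 ν (termsBefore ts) _)
          (eval-qfTree _ 𝒮 ν _
            (λ { (inj₁ i) → eval-params i
               ; (inj₂ j) → trans (sym (lookup-map j _ (eval 𝒮 ν (termsBefore ts))))
                              (cong (λ us → lookup us j) (eval-termsBefore ts)) })
            (updRel P b S R))
      eval-atomBefore (eq t u)      =
        trans (eval->>= 𝒮 ν (termBefore t) _)
          (trans (eval->>= 𝒮 ν (termBefore u) _)
            (trans (eval-test 𝒮 ν (eq (eval 𝒮 ν (termBefore t)) (eval 𝒮 ν (termBefore u))))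
              (cong₂ (λ x y → ⌊ x ≟ᶠ y ⌋) (eval-termBefore t) (eval-termBefore u))))

      eval-treeBefore : ∀ {X} (d : Tree σ A (Fin M) X) → eval 𝒮 ν (treeBefore d) ≡ eval 𝒮′ ν d
      eval-treeBefore (leaf x)     = refl
      eval-treeBefore (node q l r)
        rewrite eval->>= 𝒮 ν (atomBefore q) (λ e → if e then treeBefore l else treeBefore r)
              | eval-atomBefore q
        with evalA 𝒮′ ν q
      ... | true  = eval-treeBefore l
      ... | false = eval-treeBefore r

  treeBeforeRun : ∀ {X} → List (Mod σ M) → Tree σ A (Fin M) X → Tree σ A (Fin M) X
  treeBeforeRun []              d = d
  treeBeforeRun (mod b S a ∷ α) d = treeBefore b S a (treeBeforeRun α d)

  -- The pulled-back tree depends on the program and the symbolic sequence only. One tree therefore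
  -- serves all domains, all initial states `𝒮` and all choices `ν` of the modified elements.
  eval-treeBeforeRun : ∀ {N} (ν : Fin M → Fin N) α (𝒮 : State σ A N) {X} (d : Tree σ A (Fin M) X) →
    eval 𝒮 ν (treeBeforeRun α d) ≡ eval (run P (List.map (mapMod ν) α) 𝒮) ν d
  eval-treeBeforeRun ν []              𝒮 d = refl
  eval-treeBeforeRun ν (mod b S a ∷ α) 𝒮 d =
    trans (eval-treeBefore b S a 𝒮 ν (treeBeforeRun α d)) (eval-treeBeforeRun ν α _ d)

-- Bounding the variables of an atom

module _ {A : AuxSchema} {V : Set} where

  varsT : Term A V → List V
  varsT (var v)   = v ∷ []
  varsT (const _) = []
  varsT (app _ t) = varsT t

  varsV : ∀ {n} → Vec (Term A V) n → List V
  varsV []       = []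
  varsV (t ∷ ts) = varsT t List.++ varsV ts

  -- The arity bound on function symbols enters here: a term is a chain of applications that ends in
  -- one variable or constant.
  length-varsT : ∀ t → length (varsT t) ≤ 1
  length-varsT (var _)   = s≤s z≤n
  length-varsT (const _) = z≤n
  length-varsT (app _ t) = length-varsT t

  length-varsV : ∀ {n} (ts : Vec (Term A V) n) → length (varsV ts) ≤ n
  length-varsV []       = z≤n
  length-varsV (t ∷ ts) =
    ≤-trans (≤-reflexive (length-++ (varsT t))) (+-mono-≤ (length-varsT t) (length-varsV ts))

  evalT-agree : ∀ {N} (𝒜 : AuxStr A N) {ν ν′ : V → Fin N} t →
    (∀ {v} → v ∈ varsT t → ν v ≡ ν′ v) → evalT 𝒜 ν t ≡ evalT 𝒜 ν′ t
  evalT-agree 𝒜 (var v)   h = h (here refl)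
  evalT-agree 𝒜 (const c) h = refl
  evalT-agree 𝒜 (app f t) h = cong (funI 𝒜 f) (evalT-agree 𝒜 t h)

  map-evalT-agree : ∀ {N} (𝒜 : AuxStr A N) {ν ν′ : V → Fin N} {n} (ts : Vec (Term A V) n) →
    (∀ {v} → v ∈ varsV ts → ν v ≡ ν′ v) → map (evalT 𝒜 ν) ts ≡ map (evalT 𝒜 ν′) ts
  map-evalT-agree 𝒜 []       h = refl
  map-evalT-agree 𝒜 (t ∷ ts) h =
    cong₂ _∷_ (evalT-agree 𝒜 t (h ∘ ∈-++⁺ˡ)) (map-evalT-agree 𝒜 ts (h ∘ ∈-++⁺ʳ (varsT t)))

max : ∀ {n} → (Fin n → ℕ) → ℕ
max = foldr _⊔_ 0

≤-max : ∀ {n} (f : Fin n → ℕ) i → f i ≤ max f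
≤-max f zero    = m≤m⊔n _ _
≤-max f (suc i) = ≤-trans (≤-max (f ∘ suc) i) (m≤n⊔m (f zero) _)

module _ {σ : RelSchema} {A : AuxSchema} where

  varsA : ∀ {V} → Atom σ A V → List V
  varsA (inRel S ts)  = varsV ts
  varsA (auxRel R ts) = varsV ts
  varsA (eq t u)      = varsT t List.++ varsT u

  evalA-agree : ∀ {V N} (𝒮 : State σ A N) {ν ν′ : V → Fin N} a →
    (∀ {v} → v ∈ varsA a → ν v ≡ ν′ v) → evalA 𝒮 ν a ≡ evalA 𝒮 ν′ a
  evalA-agree 𝒮 (inRel S ts)  h = cong (proj₁ 𝒮 S) (map-evalT-agree (proj₂ 𝒮) ts h)
  evalA-agree 𝒮 (auxRel R ts) h = cong (relI (proj₂ 𝒮) R) (map-evalT-agree (proj₂ 𝒮) ts h)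
  evalA-agree 𝒮 (eq t u)      h =
    cong₂ (λ x y → ⌊ x ≟ᶠ y ⌋) (evalT-agree (proj₂ 𝒮) t (h ∘ ∈-++⁺ˡ))
      (evalT-agree (proj₂ 𝒮) u (h ∘ ∈-++⁺ʳ (varsT t)))

  -- The summand 2 covers equality atoms. Adding the three bounds instead of taking their maximum is
  -- harmless, as any number that depends on the schemas alone will do.
  width : ℕ
  width = 2 + (max (arity σ) + max (arity (rels A)))

  length-varsA : ∀ {V} (a : Atom σ A V) → length (varsA a) ≤ width
  length-varsA (inRel S ts)  =
    ≤-trans (length-varsV ts) (≤-trans (≤-max (arity σ) S) (≤-trans (m≤m+n _ _) (m≤n+m _ 2)))
  length-varsA (auxRel R ts) =
    ≤-trans (length-varsV ts)
      (≤-trans (≤-max (arity (rels A)) R) (≤-trans (m≤n+m _ (max (arity σ))) (m≤n+m _ 2)))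
  length-varsA (eq t u)      =
    ≤-trans (≤-reflexive (length-++ (varsT t)))
      (≤-trans (+-mono-≤ (length-varsT t) (length-varsT u)) (m≤m+n 2 _))

-- Pigeonhole arguments and tuples with one position reset

-- If all `r + 1` values occurred, two of them would share an index of the list and hence be equal.
missing : ∀ {r} (xs : List (Fin (suc r))) → length xs ≤ r → ∃ λ v → v ∉ xs
missing xs len = ¬∀⟶∃¬ _ (_∈ xs) (_∈? xs) λ all →
  let i , j , i<j , same = pigeonhole (s≤s len) (index ∘ all)
  in <⇒≢ i<j (trans (lookup-index (all i))
       (trans (cong (List.lookup xs) same) (sym (lookup-index (all j)))))
  where open DecMembership _≟ᶠ_ using (_∈?_)

funToFin-cong : ∀ {m n} {f g : Fin m → Fin n} → f ≗ g → funToFin f ≡ funToFin g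
funToFin-cong {zero}  h = refl
funToFin-cong {suc m} h = cong₂ combine (h zero) (funToFin-cong (h ∘ suc))

-- Numbering the Boolean functions on both sides maps `2 ^ a` numbers to `2 ^ b`. Functions are
-- compared pointwise throughout, for want of extensionality.
pigeonhole-Bool : ∀ {a b} → b < a → (c : (Fin a → Bool) → Fin b → Bool) →
                  ∃₂ λ F G → ¬ F ≗ G × c F ≗ c G
pigeonhole-Bool {a} {b} b<a c =
  let i , j , i<j , same = pigeonhole (^-monoʳ-< 2 (s≤s (s≤s z≤n)) b<a) encode in
  family i , family j ,
  (λ F≗G → <⇒≢ i<j (begin
    i                             ≡⟨ funToFin-finToFin {a} i ⟨
    funToFin (finToFun {2} {a} i) ≡⟨ funToFin-cong (λ s → to-injective (F≗G s)) ⟩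
    funToFin (finToFun {2} {a} j) ≡⟨ funToFin-finToFin {a} j ⟩
    j                             ∎)) ,
  λ k → from-injective (begin
    Inverse.from 2↔Bool (c (family i) k)  ≡⟨ finToFun-funToFin {b} _ k ⟨
    finToFun {2} {b} (encode i) k         ≡⟨ cong (λ x → finToFun {2} {b} x k) same ⟩
    finToFun {2} {b} (encode j) k         ≡⟨ finToFun-funToFin {b} _ k ⟩
    Inverse.from 2↔Bool (c (family j) k)  ∎)
  where
  family : Fin (2 ^ a) → Fin a → Bool
  family i = Inverse.to 2↔Bool ∘ finToFun i

  encode : Fin (2 ^ a) → Fin (2 ^ b)
  encode i = funToFin (Inverse.from 2↔Bool ∘ c (family i))

  to-injective : ∀ {x y} → Inverse.to 2↔Bool x ≡ Inverse.to 2↔Bool y → x ≡ y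
  to-injective = Injection.injective (Inverse⇒Injection 2↔Bool)

  from-injective : ∀ {x y} → Inverse.from 2↔Bool x ≡ Inverse.from 2↔Bool y → x ≡ y
  from-injective = Injection.injective (Inverse⇒Injection (↔-sym 2↔Bool))

-- A position `w` other than `v` survives the removal at index `punchOut v≢w`, and the insertion
-- moves it back to `w`, whatever `x` is filled in at `v`.
insertAt-removeAt-≢ : ∀ {n} {X : Set} (xs : Fin (suc n) → X) {v w} (x : X) (ys : Fin n → X) →
  v ≢ w → ys ≗ removeAt xs v → insertAt ys v x w ≡ xs w
insertAt-removeAt-≢ xs {v} {w} x ys v≢w h = begin
  insertAt ys v x w                            ≡⟨ cong (insertAt ys v x) (punchIn-punchOut v≢w) ⟨
  insertAt ys v x (punchIn v (punchOut v≢w))   ≡⟨ insertAt-punchIn ys v x (punchOut v≢w) ⟩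
  ys (punchOut v≢w)                            ≡⟨ h (punchOut v≢w) ⟩
  xs (punchIn v (punchOut v≢w))                ≡⟨ cong xs (punchIn-punchOut v≢w) ⟩
  xs w                                         ∎

≡true-injective : ∀ {b c} → (b ≡ true → c ≡ true) → (c ≡ true → b ≡ true) → b ≡ c
≡true-injective {true}  f g = sym (f refl)
≡true-injective {false} {true}  f g = g refl
≡true-injective {false} {false} f g = refl

-- The query and the effect of insertions into `U`

σ₀ : RelSchema
σ₀ = record { nRel = 2 ; arity = λ { zero → 1 ; (suc _) → 2 } }

pattern U = zero
pattern E = suc zero

ψ₀ : QF σ₀ emptyAux (Fin 1 ⊎ Fin 1)
ψ₀ = disj (neg (inRel U (var (inj₂ zero) ∷ [])))
          (inRel E (var (inj₁ zero) ∷ var (inj₂ zero) ∷ []))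

insertions : ∀ {M} → List (Fin M) → List (Mod σ₀ M)
insertions = List.map λ w → mod true U (w ∷ [])

module _ {M N : ℕ} (ν : Fin M → Fin N) where

  inserted : List (Fin M) → Database σ₀ N → Database σ₀ N
  inserted ws = applyMods (List.map (mapMod ν) (insertions ws))

  inserted-E : ∀ ws 𝒟 t → inserted ws 𝒟 E t ≡ 𝒟 E t
  inserted-E []       𝒟 t = refl
  inserted-E (w ∷ ws) 𝒟 t = inserted-E ws (applyMod (mod true U (ν w ∷ [])) 𝒟) t

  inserted-mono : ∀ ws 𝒟 {t} → 𝒟 U t ≡ true → inserted ws 𝒟 U t ≡ true
  inserted-mono []       𝒟     h = h
  inserted-mono (w ∷ ws) 𝒟 {t} h = inserted-mono ws (applyMod (mod true U (ν w ∷ [])) 𝒟) new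
    where
    new : applyMod (mod true U (ν w ∷ [])) 𝒟 U t ≡ true
    new with ≡-dec _≟ᶠ_ (ν w ∷ []) t
    ... | yes _ = refl
    ... | no _  = h

  inserted-∈ : ∀ {ws w} 𝒟 → w ∈ ws → inserted ws 𝒟 U (ν w ∷ []) ≡ true
  inserted-∈ {w ∷ ws} 𝒟 (here refl) = inserted-mono ws (applyMod (mod true U (ν w ∷ [])) 𝒟) new
    where
    new : applyMod (mod true U (ν w ∷ [])) 𝒟 U (ν w ∷ []) ≡ true
    new with ≡-dec _≟ᶠ_ (ν w ∷ []) (ν w ∷ [])
    ... | yes _  = refl
    ... | no  ne = contradiction refl ne
  inserted-∈ 𝒟 (there w∈ws) = inserted-∈ _ w∈ws

  inserted⁻ : ∀ ws 𝒟 {y} → inserted ws 𝒟 U (y ∷ []) ≡ true → 𝒟 U (y ∷ []) ≡ true ⊎ ∃ λ w → ν w ≡ y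
  inserted⁻ []       𝒟     h = inj₁ h
  inserted⁻ (w ∷ ws) 𝒟 {y} h with inserted⁻ ws (applyMod (mod true U (ν w ∷ [])) 𝒟) h
  ... | inj₂ p = inj₂ p
  ... | inj₁ q with ≡-dec _≟ᶠ_ (ν w ∷ []) (y ∷ [])
  ...   | yes refl = inj₂ (w , refl)
  ...   | no _     = inj₁ q

-- Databases that encode sets of tuples

module Family (r K : ℕ) where

  m n X N : ℕ
  m = suc r
  n = suc K
  X = n ^ m
  -- Chosen so that `suc N` unfolds to `m * n + X`: the domain consists of the points followed by
  -- the rows.
  N = K + r * n + X

  point : Fin m → Fin n → Fin (suc N)
  point w j = combine w j ↑ˡ X

  row : Fin X → Fin (suc N)
  row s = (m * n) ↑ʳ s

  entry : (Fin X → Bool) → Fin X → Fin m × Fin n → Bool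
  entry F s (w , j) = F s ∧ ⌊ finToFun s w ≟ᶠ j ⌋

  -- Edges lead from rows to points only, so once `U` contains a point, every witness of the query
  -- is a row.
  edge : (Fin X → Bool) → Fin (m * n) ⊎ Fin X → Fin (m * n) ⊎ Fin X → Bool
  edge F (inj₂ s) (inj₁ p) = entry F s (remQuot {m} n p)
  edge F _        _        = false

  db : (Fin X → Bool) → Database σ₀ (suc N)
  db F U _            = false
  db F E (x ∷ y ∷ []) = edge F (splitAt (m * n) x) (splitAt (m * n) y)

  edge-row : ∀ F s w j → db F E (row s ∷ point w j ∷ []) ≡ F s ∧ ⌊ finToFun {n} {m} s w ≟ᶠ j ⌋
  edge-row F s w j =
    trans (cong₂ (edge F) (splitAt-↑ʳ (m * n) X s) (splitAt-↑ˡ (m * n) (combine w j) X))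
      (cong (entry F s) (remQuot-combine {m} w j))

  entry⁻ : ∀ F s w j → entry F s (w , j) ≡ true → F s ≡ true × finToFun s w ≡ j
  entry⁻ F s w j h with F s | finToFun s w ≟ᶠ j
  ... | true | yes q = refl , q

  edge⁻ : ∀ F x w j → db F E (x ∷ point w j ∷ []) ≡ true →
          ∃ λ s → splitAt (m * n) x ≡ inj₂ s × F s ≡ true × finToFun {n} {m} s w ≡ j
  edge⁻ F x w j h
    with splitAt (m * n) x
       | trans (cong (edge F (splitAt (m * n) x)) (sym (splitAt-↑ˡ (m * n) (combine w j) X))) h
  ... | inj₂ s | e = s , refl , entry⁻ F s w j
    (trans (cong (entry F s) (sym (remQuot-combine {m} w j))) e)

  module _ (s : Fin X) where

    ν : Fin m → Fin (suc N)
    ν w = point w (finToFun s w)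

    -- The row of `s` is the witness: it is joined to every point of `s`, and `U` contains nothing
    -- else.
    query⁺ : ∀ F → F s ≡ true → EAQuery ψ₀ N (inserted ν (allFin m) (db F))
    query⁺ F Fs = (λ _ → row s) , covers
      where
      covers : ∀ (y : Fin 1 → Fin (suc N)) →
        not (inserted ν (allFin m) (db F) U (y zero ∷ [])) ∨
        inserted ν (allFin m) (db F) E (row s ∷ y zero ∷ []) ≡ true
      covers y with inserted ν (allFin m) (db F) U (y zero ∷ []) in h
      ... | false = refl
      ... | true with inserted⁻ ν (allFin m) (db F) h
      -- `U` is empty in `db F`, so only inserted points remain.
      ...   | inj₂ (w , νw≡y)
        rewrite sym νw≡y
              | inserted-E ν (allFin m) (db F) (row s ∷ ν w ∷ [])
              | edge-row F s w (finToFun s w)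
              | Fs
        with finToFun {n} {m} s w ≟ᶠ finToFun s w
      ...     | yes _ = refl
      ...     | no ne = contradiction refl ne

    -- A witness is joined to every point of `s`. It is thus a row in `F` that agrees with `s` at
    -- each position, and the tuple determines the row.
    query⁻ : ∀ F → EAQuery ψ₀ N (inserted ν (allFin m) (db F)) → F s ≡ true
    query⁻ F (x , covers) =
      subst (λ s → F s ≡ true) s₀≡s (proj₁ (proj₂ (proj₂ (found zero))))
      where
      found : ∀ w → ∃ λ s′ → splitAt (m * n) (x zero) ≡ inj₂ s′ × F s′ ≡ true ×
                            finToFun {n} {m} s′ w ≡ finToFun s w
      found w with covers (λ _ → ν w)
      ... | h
        rewrite inserted-∈ ν (db F) (∈-allFin w)
              | inserted-E ν (allFin m) (db F) (x zero ∷ ν w ∷ []) =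
        edge⁻ F (x zero) w (finToFun s w) h

      s₀ : Fin X
      s₀ = proj₁ (found zero)

      agree : ∀ w → finToFun {n} {m} s₀ w ≡ finToFun s w
      agree w with found zero | found w
      -- Both rows are read off the same element `x zero`, so they coincide.
      ... | _ , p , _ | _ , q , _ , e with trans (sym p) q
      ...   | refl = e

      s₀≡s : s₀ ≡ s
      s₀≡s = begin
        s₀                              ≡⟨ funToFin-finToFin {m} {n} s₀ ⟨
        funToFin (finToFun {n} {m} s₀)  ≡⟨ funToFin-cong agree ⟩
        funToFin (finToFun {n} {m} s)   ≡⟨ funToFin-finToFin {m} {n} s ⟩
        s                               ∎

-- Counting the information available to a tree

module _ {A : AuxSchema} (r : ℕ) (narrow : ∀ a → length (varsA {σ₀} {A} {Fin (suc r)} a) ≤ r)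
         (tree : Tree σ₀ A (Fin (suc r)) Bool)
         (Init : (n : ℕ) → Database σ₀ (suc n) → AuxStr A (suc n)) where

  asked : List (Atom σ₀ A (Fin (suc r)))
  asked = atoms tree

  K : ℕ
  K = length asked

  open Family r K

  initial : (Fin X → Bool) → State σ₀ A (suc N)
  initial F = db F , Init N (db F)

  free : (k : Fin K) → ∃ λ v → v ∉ varsA (List.lookup asked k)
  free k = missing _ (narrow (List.lookup asked k))

  -- The points of the tuple coded by c, with an arbitrary 0 at the position v the atom does not mention.
  reset : Fin m → Fin (n ^ r) → Fin m → Fin (suc N)
  reset v c w = point w (insertAt (finToFun {n} {r} c) v zero w)

  answer : (Fin X → Bool) → Fin K × Fin (n ^ r) → Bool
  answer F (k , c) = evalA (initial F) (reset (proj₁ (free k)) c) (List.lookup asked k)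

  -- These `K * n ^ r` bits are all that the atoms of the tree can reveal about `F`, over all tuples
  -- `s` together.
  code : (Fin X → Bool) → Fin (K * n ^ r) → Bool
  code F i = answer F (remQuot (n ^ r) i)

  -- Resetting the free position changes `ν s` only at a variable that the atom does not mention, so
  -- the remaining `r` entries of the tuple determine the truth value.
  evalA-code : ∀ F s k → evalA (initial F) (ν s) (List.lookup asked k) ≡
    code F (combine k (funToFin (removeAt (finToFun {n} {m} s) (proj₁ (free k)))))
  evalA-code F s k = trans
    (evalA-agree (initial F) (List.lookup asked k) λ {w} w∈ → cong (point w) (sym
      (insertAt-removeAt-≢ (finToFun {n} {m} s) {proj₁ (free k)} {w} zero _
        (λ v≡w → proj₂ (free k) (subst (_∈ varsA (List.lookup asked k)) (sym v≡w) w∈))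
        (finToFun-funToFin (removeAt (finToFun {n} {m} s) (proj₁ (free k)))))))
    (cong (answer F) (sym (remQuot-combine k _)))

  eval-same : ∀ {F G} → code F ≗ code G → ∀ s →
              eval (initial F) (ν s) tree ≡ eval (initial G) (ν s) tree
  eval-same {F} {G} same s = eval-agree (initial F) (ν s) (initial G) (ν s) tree λ {a} a∈ →
    subst (λ a → evalA (initial F) (ν s) a ≡ evalA (initial G) (ν s) a) (sym (lookup-index a∈))
      (trans (evalA-code F s (index a∈)) (trans (same _) (sym (evalA-code G s (index a∈)))))

  -- As `n` is `suc K`, the number `X` unfolds to `n ^ r + K * n ^ r`, and the first summand is
  -- positive.
  K*n^r<X : K * n ^ r < X
  K*n^r<X = m<n+m _ (m^n>0 n r)

  -- Two different sets share a code, so the tree gives the same answers for both. A correct tree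
  -- would recover each set from its answers and make them equal.
  tree-fails : ¬ (∀ F s → eval (initial F) (ν s) tree ≡ true ⇔ F s ≡ true)
  tree-fails decides with pigeonhole-Bool K*n^r<X code
  ... | F , G , F≢G , same =
    F≢G λ s → ≡true-injective (transfer same s) (transfer (sym ∘ same) s)
    where
    transfer : ∀ {F G} → code F ≗ code G → ∀ s → F s ≡ true → G s ≡ true
    transfer {F} {G} same s Fs =
      Equivalence.to (decides G s)
        (trans (sym (eval-same same s)) (Equivalence.from (decides F s) Fs))

-- From a maintaining program to a decision tree

module _ {σ : RelSchema} {A : AuxSchema} (Q : Fin (nRel (rels A))) (p : arity (rels A) Q ≡ 0) where

  queryTree : ∀ {V} → Tree σ A V Bool
  queryTree = test (auxRel Q (subst (Vec _) (sym p) []))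

  eval-query : ∀ {V N} (𝒮 : State σ A N) (ν : V → Fin N) → eval 𝒮 ν queryTree ≡ queryValue Q p 𝒮
  eval-query 𝒮 ν =
    trans (eval-test 𝒮 ν (auxRel Q (subst (Vec _) (sym p) [])))
      (cong (relI (proj₂ 𝒮) Q) (map-[] (sym p)))
    where
    -- The arity is generalised to a variable `k` so that the equation can be matched with `refl`.
    map-[] : ∀ {k} (q : 0 ≡ k) → map (evalT (proj₂ 𝒮) ν) (subst (Vec _) q []) ≡ subst (Vec _) q []
    map-[] refl = refl

module _ {A : AuxSchema} (P : UpdateProgram σ₀ A)
         (Init : (n : ℕ) → Database σ₀ (suc n) → AuxStr A (suc n))
         (Q : Fin (nRel (rels A))) (p : arity (rels A) Q ≡ 0)
         (maintains : Maintains P Init Q p (EAQuery ψ₀)) where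

  -- Pulling the query symbol back along `r + 1` symbolic insertions into `U` gives a tree that
  -- would decide `F s` from the initial state alone.
  unmaintained : ∀ r → ¬ (∀ a → length (varsA {σ₀} {A} {Fin (suc r)} a) ≤ r)
  unmaintained r narrow = tree-fails r narrow tree Init λ F s →
      mk⇔ (λ e → query⁻ s F (Equivalence.to (correct F s) (trans (sym (eval-tree F s)) e)))
          (λ Fs → trans (eval-tree F s) (Equivalence.from (correct F s) (query⁺ s F Fs)))
    where
    α : List (Mod σ₀ (suc r))
    α = insertions (allFin (suc r))

    tree : Tree σ₀ A (Fin (suc r)) Bool
    tree = treeBeforeRun P α (queryTree Q p)

    -- The domain is sized by the number of atoms of the tree. This is not circular, as the tree is
    -- built from variables before any domain is fixed.
    open Family r (length (atoms tree))

    correct : ∀ F s →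
      queryValue Q p (run P (List.map (mapMod (ν s)) α) (db F , Init N (db F))) ≡ true ⇔
      EAQuery ψ₀ N (inserted (ν s) (allFin m) (db F))
    correct F s = maintains N (db F) (List.map (mapMod (ν s)) α)

    eval-tree : ∀ F s → eval (db F , Init N (db F)) (ν s) tree ≡
      queryValue Q p (run P (List.map (mapMod (ν s)) α) (db F , Init N (db F)))
    eval-tree F s =
      trans (eval-treeBeforeRun P (ν s) α _ _)
        (eval-query Q p (run P (List.map (mapMod (ν s)) α) _) (ν s))

theorem6p2 : Σ RelSchema λ σ → Σ ℕ λ k → Σ ℕ λ m →
    Σ (QF σ emptyAux (Fin k ⊎ Fin m)) λ ψ →
    (A : AuxSchema) (P : UpdateProgram σ A)
    (Init : (n : ℕ) → Database σ (suc n) → AuxStr A (suc n))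
    (Q : Fin (nRel (rels A))) (p : arity (rels A) Q ≡ 0) →
    ¬ Maintains P Init Q p (EAQuery ψ)
theorem6p2 = σ₀ , 1 , 1 , ψ₀ , λ A P Init Q p maintains →
  -- `width` bounds atoms over every set of variables, so it may also determine the number `suc r`
  -- of variables.
  unmaintained P Init Q p maintains (width {σ₀} {A}) length-varsA
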